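{- Let $C$ be an extended linear code of length $d+1$ over $\mathbb{Z}_N$ and let $g=(g_{ji})$ be a generating matrix of $C$, with $m$ rows and with columns indexed by $i=0,\dots,d$. Put $\gcd_i=\gcd(g_{1i},\dots,g_{mi},N)$. If $C$ is thin and every $\gcd_i=1$ (in particular, if $N$ is prime), then $d\ge N$.
   Context: $\mathbb{Z}_N=\mathbb{Z}/N\mathbb{Z}$; its elements are identified with the representatives $0,1,\dots,N-1$, and gcd's are taken of these integers. A linear code of length $n$ over $\mathbb{Z}_N$ is a submodule $C\subseteq\mathbb{Z}_N^n$; its elements are called words; a generating matrix is a matrix whose rows generate $C$. $C$ is extended if every word has coordinate sum $0\bmod N$. An extended code is thin if it contains no word all of whose entries are nonzero.
   Formalization: The case N = 1, d = 0 is excluded (there C = {0} is a counterexample), and for N prime it is additionally assumed that no column of g is zero, since with a zero column gcd_i = N and the claim fails (e.g. C = {0}, d = 0). -}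

module Defs where

open import Level using (Level)
open import Data.Nat using (ℕ; NonZero) renaming (_+_ to _+ℕ_; _*_ to _*ℕ_)
open import Data.Nat.DivMod using (_mod_)
open import Data.Nat.GCD using (gcd)
open import Data.Fin using (Fin; toℕ)
open import Data.Product using (∃; _×_)
open import Data.Vec using (Vec; foldr′; lookup; map; replicate; zipWith)
open import Function.Bundles using (_⇔_)
open import Relation.Binary.PropositionalEquality using (_≡_; _≢_)
open import Relation.Nullary using (¬_)
open import Relation.Unary using (Pred; _∈_)

private
  variable
    ℓ : Level
    N m n : ℕ

-- Elements of ℤ/Nℤ are their representatives 0, …, N-1.
ℤ/ : ℕ → Set
ℤ/ N = Fin N

infixl 6 _+_ _⊕_
infixl 7 _*_ _·_

0# : .{{_ : NonZero N}} → ℤ/ N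
0# {N = N} = 0 mod N

_+_ : .{{_ : NonZero N}} → ℤ/ N → ℤ/ N → ℤ/ N
_+_ {N = N} x y = (toℕ x +ℕ toℕ y) mod N

_*_ : .{{_ : NonZero N}} → ℤ/ N → ℤ/ N → ℤ/ N
_*_ {N = N} x y = (toℕ x *ℕ toℕ y) mod N

Word : ℕ → ℕ → Set
Word N n = Vec (ℤ/ N) n

0ʷ : .{{_ : NonZero N}} → Word N n
0ʷ {n = n} = replicate n 0#

_⊕_ : .{{_ : NonZero N}} → Word N n → Word N n → Word N n
_⊕_ = zipWith _+_

_·_ : .{{_ : NonZero N}} → ℤ/ N → Word N n → Word N n
a · w = map (a *_) w

coordinateSum : .{{_ : NonZero N}} → Word N n → ℤ/ N
coordinateSum = foldr′ _+_ 0#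

-- Closure under negation is the case a = N-1 of ·-closed.
record IsLinearCode {N n : ℕ} .{{_ : NonZero N}} (C : Pred (Word N n) ℓ) : Set ℓ where
  field
    0-closed : 0ʷ ∈ C
    ⊕-closed : ∀ {v w} → v ∈ C → w ∈ C → v ⊕ w ∈ C
    ·-closed : ∀ a {w} → w ∈ C → a · w ∈ C

Matrix : ℕ → ℕ → ℕ → Set
Matrix N m n = Vec (Word N n) m

entry : Matrix N m n → Fin m → Fin n → ℤ/ N
entry g j i = lookup (lookup g j) i

-- The linear combination Σⱼ aⱼ · gⱼ of the rows gⱼ of g.
combination : .{{_ : NonZero N}} → Vec (ℤ/ N) m → Matrix N m n → Word N n
combination a g = foldr′ _⊕_ 0ʷ (zipWith _·_ a g)

IsGeneratingMatrix : .{{_ : NonZero N}} → Matrix N m n → Pred (Word N n) ℓ → Set ℓ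
IsGeneratingMatrix {N = N} {m = m} g C =
  ∀ w → w ∈ C ⇔ ∃ λ (a : Vec (ℤ/ N) m) → w ≡ combination a g

IsExtended : .{{_ : NonZero N}} → Pred (Word N n) ℓ → Set ℓ
IsExtended C = ∀ w → w ∈ C → coordinateSum w ≡ 0#

-- This is the condition defining thinness among extended codes;
-- extendedness itself is IsExtended.
IsThin : .{{_ : NonZero N}} → Pred (Word N n) ℓ → Set ℓ
IsThin C = ¬ (∃ λ w → w ∈ C × (∀ i → lookup w i ≢ 0#))

-- gcd(g₁ᵢ, …, gₘᵢ, N), taken in ℕ.
columnGcd : Matrix N m n → Fin n → ℕ
columnGcd {N = N} g i = foldr′ gcd N (map (λ row → toℕ (lookup row i)) g)

{-# OPTIONS --safe #-}

-- Count the zero coordinates of the words Σⱼ aⱼ gⱼ, over all coefficient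
-- vectors a ∈ ℤ_N^m.  As gcdᵢ = 1, Bézout gives a vector c whose word has
-- i-th coordinate 1; translating a by k·c for k ∈ ℤ_N shows that the i-th
-- coordinate is equidistributed, so it vanishes for exactly a fraction 1/N of
-- the a's.  A word thus has (d+1)/N zeros on average.  By thinness it always
-- has at least one, and the zero word has d+1 > 1 of them when d > 0; hence
-- d+1 > N.  When d = 0 one only gets N ≤ 1.

module Submission where

open import Defs
open import Algebra.Bundles using (CommutativeRing)
import Algebra.Properties.CommutativeSemigroup as CommutativeSemigroupProperties
open import Data.Bool using (if_then_else_)
open import Data.Fin using (Fin; zero; suc; toℕ; _≟_)
open import Data.Fin.Permutation using (Permutation′; permutation)
open import Data.Fin.Properties
  using (any?; fromℕ<-cong; toℕ-fromℕ<; toℕ-injective; toℕ<n)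
open import Data.Nat
  using (ℕ; zero; suc; pred; NonZero; _≤_; _<_; z≤n; s≤s; s≤s⁻¹; >-nonZero; >-nonZero⁻¹)
import Data.Nat as ℕ
open import Data.Nat.Divisibility using (_∣_; ∣-refl; ∣-trans; n∣m⇒m%n≡0)
open import Data.Nat.DivMod
  using (_%_; _mod_; m%n<n; m<n⇒m%n≡m; m*n%n≡0; n%n≡0; %-distribˡ-+; %-distribˡ-*)
open import Data.Nat.GCD using (gcd[m,n]∣m; gcd[m,n]∣n; gcd-GCD; module Bézout)
open import Data.Nat.Primality using (Prime; ¬prime[1]; prime⇒irreducible)
import Data.Nat.Properties as ℕ
open import Data.Product using (∃; _×_; _,_; proj₁; proj₂)
open import Data.Sum using (inj₁; inj₂)
open import Data.Vec using (Vec; []; _∷_; lookup)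
open import Data.Vec.Properties using (lookup-map; lookup-replicate; lookup-zipWith)
open import Function using (_∘_)
open import Function.Bundles using (Equivalence)
open import Level using (0ℓ)
open import Relation.Binary.PropositionalEquality
  using (_≡_; _≢_; refl; sym; trans; cong; cong₂; subst; isEquivalence; module ≡-Reasoning)
open import Relation.Nullary using (¬_; does; yes; no; contradiction)
open import Relation.Nullary.Decidable using (dec-true)
open import Relation.Unary using (Pred)

open import Algebra.Properties.CommutativeMonoid.Sum ℕ.+-0-commutativeMonoid
  using (sum; sum-syntax; sum-cong-≗; ∑-comm; ∑-permute; sum-replicate-zero)

private
  variable
    N m n : ℕ

-- The ring ℤ/N

mod-cong : ∀ .{{_ : NonZero N}} {a b} → a % N ≡ b % N → a mod N ≡ b mod N
mod-cong eq = fromℕ<-cong _ _ eq _ _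

toℕ-mod : ∀ .{{_ : NonZero N}} a → toℕ (a mod N) ≡ a % N
toℕ-mod {N} a = toℕ-fromℕ< (m%n<n a N)

mod-toℕ : .{{_ : NonZero N}} (x : ℤ/ N) → toℕ x mod N ≡ x
mod-toℕ {N} x = toℕ-injective (trans (toℕ-mod (toℕ x)) (m<n⇒m%n≡m (toℕ<n x)))

mod-homo-+ : ∀ .{{_ : NonZero N}} a b → (a ℕ.+ b) mod N ≡ a mod N + b mod N
mod-homo-+ {N} a b = trans (mod-cong (%-distribˡ-+ a b N))
  (cong₂ (λ x y → (x ℕ.+ y) mod N) (sym (toℕ-mod a)) (sym (toℕ-mod b)))

mod-homo-* : ∀ .{{_ : NonZero N}} a b → (a ℕ.* b) mod N ≡ a mod N * (b mod N)
mod-homo-* {N} a b = trans (mod-cong (%-distribˡ-* a b N))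
  (cong₂ (λ x y → (x ℕ.* y) mod N) (sym (toℕ-mod a)) (sym (toℕ-mod b)))

1# : .{{_ : NonZero N}} → ℤ/ N
1# {N} = 1 mod N

infix 8 -_
-_ : .{{_ : NonZero N}} → ℤ/ N → ℤ/ N
-_ {N} x = pred N mod N * x

module _ {N : ℕ} .{{_ : NonZero N}} where

  open ≡-Reasoning

  mod-+-toℕ : ∀ a (x : ℤ/ N) → a mod N + x ≡ (a ℕ.+ toℕ x) mod N
  mod-+-toℕ a x = trans (cong (a mod N +_) (sym (mod-toℕ x))) (sym (mod-homo-+ a (toℕ x)))

  mod-*-toℕ : ∀ a (x : ℤ/ N) → a mod N * x ≡ (a ℕ.* toℕ x) mod N
  mod-*-toℕ a x = trans (cong (a mod N *_) (sym (mod-toℕ x))) (sym (mod-homo-* a (toℕ x)))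

  +-comm : (x y : ℤ/ N) → x + y ≡ y + x
  +-comm x y = cong (_mod N) (ℕ.+-comm (toℕ x) (toℕ y))

  *-comm : (x y : ℤ/ N) → x * y ≡ y * x
  *-comm x y = cong (_mod N) (ℕ.*-comm (toℕ x) (toℕ y))

  +-assoc : (x y z : ℤ/ N) → (x + y) + z ≡ x + (y + z)
  +-assoc x y z = begin
    (x + y) + z                          ≡⟨ mod-+-toℕ (toℕ x ℕ.+ toℕ y) z ⟩
    (toℕ x ℕ.+ toℕ y ℕ.+ toℕ z) mod N    ≡⟨ cong (_mod N) (ℕ.+-assoc (toℕ x) (toℕ y) (toℕ z)) ⟩
    (toℕ x ℕ.+ (toℕ y ℕ.+ toℕ z)) mod N  ≡⟨ mod-homo-+ (toℕ x) _ ⟩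
    toℕ x mod N + (y + z)                ≡⟨ cong (_+ (y + z)) (mod-toℕ x) ⟩
    x + (y + z)                          ∎

  *-assoc : (x y z : ℤ/ N) → (x * y) * z ≡ x * (y * z)
  *-assoc x y z = begin
    (x * y) * z                          ≡⟨ mod-*-toℕ (toℕ x ℕ.* toℕ y) z ⟩
    (toℕ x ℕ.* toℕ y ℕ.* toℕ z) mod N    ≡⟨ cong (_mod N) (ℕ.*-assoc (toℕ x) (toℕ y) (toℕ z)) ⟩
    (toℕ x ℕ.* (toℕ y ℕ.* toℕ z)) mod N  ≡⟨ mod-homo-* (toℕ x) _ ⟩
    toℕ x mod N * (y * z)                ≡⟨ cong (_* (y * z)) (mod-toℕ x) ⟩
    x * (y * z)                          ∎

  *-distribʳ-+ : (x y z : ℤ/ N) → (y + z) * x ≡ y * x + z * x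
  *-distribʳ-+ x y z = begin
    (y + z) * x                                      ≡⟨ mod-*-toℕ (toℕ y ℕ.+ toℕ z) x ⟩
    ((toℕ y ℕ.+ toℕ z) ℕ.* toℕ x) mod N              ≡⟨ cong (_mod N) (ℕ.*-distribʳ-+ (toℕ x) (toℕ y) (toℕ z)) ⟩
    (toℕ y ℕ.* toℕ x ℕ.+ toℕ z ℕ.* toℕ x) mod N      ≡⟨ mod-homo-+ (toℕ y ℕ.* toℕ x) _ ⟩
    y * x + z * x                                    ∎

  +-identityˡ : (x : ℤ/ N) → 0# + x ≡ x
  +-identityˡ x = trans (mod-+-toℕ 0 x) (mod-toℕ x)

  *-identityˡ : (x : ℤ/ N) → 1# * x ≡ x
  *-identityˡ x = begin
    1# * x                ≡⟨ mod-*-toℕ 1 x ⟩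
    (1 ℕ.* toℕ x) mod N   ≡⟨ cong (_mod N) (ℕ.*-identityˡ (toℕ x)) ⟩
    toℕ x mod N           ≡⟨ mod-toℕ x ⟩
    x                     ∎

  -‿inverseʳ : (x : ℤ/ N) → x + - x ≡ 0#
  -‿inverseʳ x = begin
    x + - x                                 ≡⟨ cong₂ _+_ (mod-toℕ x) (sym (mod-*-toℕ (pred N) x)) ⟨
    toℕ x mod N + (pred N ℕ.* toℕ x) mod N  ≡⟨ mod-homo-+ (toℕ x) _ ⟨
    (suc (pred N) ℕ.* toℕ x) mod N          ≡⟨ cong (λ k → (k ℕ.* toℕ x) mod N) (ℕ.suc-pred N) ⟩
    (N ℕ.* toℕ x) mod N                     ≡⟨ cong (_mod N) (ℕ.*-comm N (toℕ x)) ⟩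
    (toℕ x ℕ.* N) mod N                     ≡⟨ mod-cong (trans (m*n%n≡0 (toℕ x) N) (sym (m*n%n≡0 0 N))) ⟩
    0#                                      ∎

ℤ/-commutativeRing : ∀ N .{{_ : NonZero N}} → CommutativeRing 0ℓ 0ℓ
ℤ/-commutativeRing N = record
  { Carrier = ℤ/ N
  ; _≈_ = _≡_
  ; _+_ = _+_
  ; _*_ = _*_
  ; -_ = -_
  ; 0# = 0#
  ; 1# = 1#
  ; isCommutativeRing = record
    { isRing = record
      { +-isAbelianGroup = record
        { isGroup = record
          { isMonoid = record
            { isSemigroup = record
              { isMagma = record { isEquivalence = isEquivalence ; ∙-cong = cong₂ _+_ }
              ; assoc = +-assoc
              }
            ; identity = comm∧idˡ⇒id +-comm +-identityˡ
            }
          ; inverse = comm∧invʳ⇒inv +-comm -‿inverseʳ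
          ; ⁻¹-cong = cong -_
          }
        ; comm = +-comm
        }
      ; *-cong = cong₂ _*_
      ; *-assoc = *-assoc
      ; *-identity = comm∧idˡ⇒id *-comm *-identityˡ
      ; distrib = comm∧distrʳ⇒distrˡ *-comm *-distribʳ-+ , *-distribʳ-+
      }
    ; *-comm = *-comm
    }
  }
  where
  open import Algebra.Consequences.Propositional
    using (comm∧idˡ⇒id; comm∧invʳ⇒inv; comm∧distrʳ⇒distrˡ)

module ℤ/ (N : ℕ) .{{_ : NonZero N}} where
  open CommutativeRing (ℤ/-commutativeRing N) public
    using (-‿inverseˡ; +-identityʳ; *-identityʳ; zeroˡ; distribˡ)
  open CommutativeSemigroupProperties
    (CommutativeRing.+-commutativeSemigroup (ℤ/-commutativeRing N)) public
    using (interchange)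

-- Sums over Fin n and over all vectors with entries in Fin N

∑-const : ∀ n c → ∑[ i < n ] c ≡ n ℕ.* c
∑-const zero    c = refl
∑-const (suc n) c = cong (c ℕ.+_) (∑-const n c)

∑-mono-≤ : {f g : Fin n → ℕ} → (∀ i → f i ≤ g i) → sum f ≤ sum g
∑-mono-≤ {zero}  f≤g = z≤n
∑-mono-≤ {suc n} f≤g = ℕ.+-mono-≤ (f≤g zero) (∑-mono-≤ (f≤g ∘ suc))

∑-mono-< : {f g : Fin n → ℕ} → (∀ i → f i ≤ g i) → ∀ i → f i < g i → sum f < sum g
∑-mono-< f≤g zero    fᵢ<gᵢ = ℕ.+-mono-<-≤ fᵢ<gᵢ (∑-mono-≤ (f≤g ∘ suc))
∑-mono-< f≤g (suc i) fᵢ<gᵢ = ℕ.+-mono-≤-< (f≤g zero) (∑-mono-< (f≤g ∘ suc) i fᵢ<gᵢ)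

∑ᵥ : (Vec (Fin N) m → ℕ) → ℕ
∑ᵥ {m = zero}  f = f []
∑ᵥ {m = suc m} f = sum (λ x → ∑ᵥ (λ v → f (x ∷ v)))

∑ᵥ-cong : {f g : Vec (Fin N) m → ℕ} → (∀ v → f v ≡ g v) → ∑ᵥ f ≡ ∑ᵥ g
∑ᵥ-cong {m = zero}  f≗g = f≗g []
∑ᵥ-cong {m = suc m} f≗g = sum-cong-≗ (λ x → ∑ᵥ-cong (λ v → f≗g (x ∷ v)))

∑ᵥ-mono-≤ : {f g : Vec (Fin N) m → ℕ} → (∀ v → f v ≤ g v) → ∑ᵥ f ≤ ∑ᵥ g
∑ᵥ-mono-≤ {m = zero}  f≤g = f≤g []
∑ᵥ-mono-≤ {m = suc m} f≤g = ∑-mono-≤ (λ x → ∑ᵥ-mono-≤ (λ v → f≤g (x ∷ v)))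

∑ᵥ-mono-< : {f g : Vec (Fin N) m → ℕ} → (∀ v → f v ≤ g v) → ∀ v → f v < g v → ∑ᵥ f < ∑ᵥ g
∑ᵥ-mono-< f≤g []      fᵥ<gᵥ = fᵥ<gᵥ
∑ᵥ-mono-< f≤g (x ∷ v) fᵥ<gᵥ =
  ∑-mono-< (λ y → ∑ᵥ-mono-≤ (λ w → f≤g (y ∷ w))) x (∑ᵥ-mono-< (λ w → f≤g (x ∷ w)) v fᵥ<gᵥ)

∑-∑ᵥ-comm : (f : Fin n → Vec (Fin N) m → ℕ) →
            ∑[ i < n ] ∑ᵥ (f i) ≡ ∑ᵥ (λ v → ∑[ i < n ] f i v)
∑-∑ᵥ-comm {m = zero}  f = refl
∑-∑ᵥ-comm {m = suc m} f = trans (∑-comm (λ i x → ∑ᵥ (λ v → f i (x ∷ v))))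
  (sum-cong-≗ (λ x → ∑-∑ᵥ-comm (λ i v → f i (x ∷ v))))

module _ {N : ℕ} .{{_ : NonZero N}} where

  translation : ℤ/ N → Permutation′ N
  translation c = permutation (_+ c) (_+ - c)
    (λ x → trans (+-assoc x (- c) c) (trans (cong (x +_) (ℤ/.-‿inverseˡ N c)) (ℤ/.+-identityʳ N x)))
    (λ x → trans (+-assoc x c (- c)) (trans (cong (x +_) (-‿inverseʳ c)) (ℤ/.+-identityʳ N x)))

  ∑-translate : ∀ (f : ℤ/ N → ℕ) c → sum f ≡ sum (λ x → f (x + c))
  ∑-translate f c = ∑-permute f (translation c)

  ∑ᵥ-translate : (f : Vec (ℤ/ N) m → ℕ) (c : Vec (ℤ/ N) m) → ∑ᵥ f ≡ ∑ᵥ (λ v → f (v ⊕ c))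
  ∑ᵥ-translate f []       = refl
  ∑ᵥ-translate f (c ∷ cs) = trans (∑-translate (λ x → ∑ᵥ (λ v → f (x ∷ v))) c)
    (sum-cong-≗ (λ x → ∑ᵥ-translate (λ v → f ((x + c) ∷ v)) cs))

-- Coordinates of linear combinations

module _ {N : ℕ} .{{_ : NonZero N}} where

  coordinate : Matrix N m n → Fin n → Vec (ℤ/ N) m → ℤ/ N
  coordinate g i a = lookup (combination a g) i

  coordinate-[] : (i : Fin n) → coordinate [] i [] ≡ 0#
  coordinate-[] i = lookup-replicate i 0#

  coordinate-∷ : ∀ (r : Word N n) (g : Matrix N m n) i x a →
                 coordinate (r ∷ g) i (x ∷ a) ≡ x * lookup r i + coordinate g i a
  coordinate-∷ r g i x a = trans (lookup-zipWith _+_ i (x · r) (combination a g))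
    (cong (_+ coordinate g i a) (lookup-map i (x *_) r))

  open ≡-Reasoning

  coordinate-⊕ : ∀ (g : Matrix N m n) i a b →
                 coordinate g i (a ⊕ b) ≡ coordinate g i a + coordinate g i b
  coordinate-⊕ []      i []      []      = trans (coordinate-[] i)
    (sym (trans (cong₂ _+_ (coordinate-[] i) (coordinate-[] i)) (+-identityˡ 0#)))
  coordinate-⊕ (r ∷ g) i (x ∷ a) (y ∷ b) = begin
    coordinate (r ∷ g) i ((x + y) ∷ (a ⊕ b))                 ≡⟨ coordinate-∷ r g i (x + y) (a ⊕ b) ⟩
    (x + y) * rᵢ + coordinate g i (a ⊕ b)                    ≡⟨ cong₂ _+_ (*-distribʳ-+ rᵢ x y) (coordinate-⊕ g i a b) ⟩
    (x * rᵢ + y * rᵢ) + (φ a + φ b)                          ≡⟨ ℤ/.interchange N (x * rᵢ) (y * rᵢ) (φ a) (φ b) ⟩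
    (x * rᵢ + φ a) + (y * rᵢ + φ b)                          ≡⟨ cong₂ _+_ (coordinate-∷ r g i x a) (coordinate-∷ r g i y b) ⟨
    coordinate (r ∷ g) i (x ∷ a) + coordinate (r ∷ g) i (y ∷ b) ∎
    where
    rᵢ = lookup r i
    φ  = coordinate g i

  coordinate-· : ∀ (g : Matrix N m n) i k a → coordinate g i (k · a) ≡ k * coordinate g i a
  coordinate-· []      i k []      = begin
    coordinate [] i []      ≡⟨ coordinate-[] i ⟩
    0#                      ≡⟨ ℤ/.zeroˡ N k ⟨
    0# * k                  ≡⟨ *-comm 0# k ⟩
    k * 0#                  ≡⟨ cong (k *_) (coordinate-[] i) ⟨
    k * coordinate [] i []  ∎
  coordinate-· (r ∷ g) i k (x ∷ a) = begin
    coordinate (r ∷ g) i ((k * x) ∷ (k · a))  ≡⟨ coordinate-∷ r g i (k * x) (k · a) ⟩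
    (k * x) * rᵢ + coordinate g i (k · a)     ≡⟨ cong₂ _+_ (*-assoc k x rᵢ) (coordinate-· g i k a) ⟩
    k * (x * rᵢ) + k * coordinate g i a       ≡⟨ ℤ/.distribˡ N k (x * rᵢ) (coordinate g i a) ⟨
    k * (x * rᵢ + coordinate g i a)           ≡⟨ cong (k *_) (coordinate-∷ r g i x a) ⟨
    k * coordinate (r ∷ g) i (x ∷ a)          ∎
    where rᵢ = lookup r i

  mod-Bézout : ∀ d x m y n → d ℕ.+ x ℕ.* m ≡ y ℕ.* n →
               - (x mod N) * (m mod N) + y mod N * (n mod N) ≡ d mod N
  mod-Bézout d x m y n eq = begin
    - x′ * m′ + y mod N * (n mod N)          ≡⟨ cong (- x′ * m′ +_) (mod-homo-* y n) ⟨
    - x′ * m′ + (y ℕ.* n) mod N              ≡⟨ cong (λ k → - x′ * m′ + k mod N) eq ⟨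
    - x′ * m′ + (d ℕ.+ x ℕ.* m) mod N        ≡⟨ cong (- x′ * m′ +_) (mod-homo-+ d (x ℕ.* m)) ⟩
    - x′ * m′ + (d mod N + (x ℕ.* m) mod N)  ≡⟨ cong (λ k → - x′ * m′ + (d mod N + k)) (mod-homo-* x m) ⟩
    - x′ * m′ + (d mod N + x′ * m′)          ≡⟨ cong (- x′ * m′ +_) (+-comm (d mod N) (x′ * m′)) ⟩
    - x′ * m′ + (x′ * m′ + d mod N)          ≡⟨ +-assoc _ _ _ ⟨
    - x′ * m′ + x′ * m′ + d mod N            ≡⟨ cong (_+ d mod N) (*-distribʳ-+ m′ (- x′) x′) ⟨
    (- x′ + x′) * m′ + d mod N               ≡⟨ cong (λ k → k * m′ + d mod N) (ℤ/.-‿inverseˡ N x′) ⟩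
    0# * m′ + d mod N                        ≡⟨ cong (_+ d mod N) (ℤ/.zeroˡ N m′) ⟩
    0# + d mod N                             ≡⟨ +-identityˡ (d mod N) ⟩
    d mod N                                  ∎
    where
    x′ = x mod N
    m′ = m mod N

  columnGcd-attained : (g : Matrix N m n) (i : Fin n) →
                       ∃ λ c → coordinate g i c ≡ columnGcd g i mod N
  columnGcd-attained []      i = [] ,
    trans (coordinate-[] i) (mod-cong (trans (m*n%n≡0 0 N) (sym (n%n≡0 N))))
  columnGcd-attained (r ∷ g) i = extend (Bézout.identity (gcd-GCD (toℕ rᵢ) G))
    where
    rᵢ = lookup r i
    G  = columnGcd g i
    a  = proj₁ (columnGcd-attained g i)

    coordinate-multiple : ∀ x y → coordinate (r ∷ g) i (x ∷ (y · a)) ≡ x * (toℕ rᵢ mod N) + y * (G mod N)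
    coordinate-multiple x y = begin
      coordinate (r ∷ g) i (x ∷ (y · a))    ≡⟨ coordinate-∷ r g i x (y · a) ⟩
      x * rᵢ + coordinate g i (y · a)       ≡⟨ cong (x * rᵢ +_) (coordinate-· g i y a) ⟩
      x * rᵢ + y * coordinate g i a         ≡⟨ cong₂ (λ p q → x * p + y * q) (sym (mod-toℕ rᵢ)) (proj₂ (columnGcd-attained g i)) ⟩
      x * (toℕ rᵢ mod N) + y * (G mod N)    ∎

    extend : Bézout.Identity (columnGcd (r ∷ g) i) (toℕ rᵢ) G →
             ∃ λ c → coordinate (r ∷ g) i c ≡ columnGcd (r ∷ g) i mod N
    extend (Bézout.+- x y eq) = (x mod N) ∷ ((- (y mod N)) · a) ,
      trans (coordinate-multiple (x mod N) (- (y mod N)))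
        (trans (+-comm (x mod N * (toℕ rᵢ mod N)) (- (y mod N) * (G mod N))) (mod-Bézout _ y G x (toℕ rᵢ) eq))
    extend (Bézout.-+ x y eq) = (- (x mod N)) ∷ ((y mod N) · a) ,
      trans (coordinate-multiple (- (x mod N)) (y mod N)) (mod-Bézout _ x (toℕ rᵢ) y G eq)

-- Counting zeros

δ₀ : .{{_ : NonZero N}} → ℤ/ N → ℕ
δ₀ x = if does (x ≟ 0#) then 1 else 0

δ₀-0 : ∀ .{{_ : NonZero N}} {x : ℤ/ N} → x ≡ 0# → δ₀ x ≡ 1
δ₀-0 {x = x} x≡0 = cong (if_then 1 else 0) (dec-true (x ≟ 0#) x≡0)

∑-δ₀ : ∀ N .{{_ : NonZero N}} → sum (δ₀ {N}) ≡ 1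
∑-δ₀ (suc n) = cong suc (sum-replicate-zero n)

zeros : .{{_ : NonZero N}} → Word N n → ℕ
zeros {n = n} w = ∑[ i < n ] δ₀ (lookup w i)

zeros-0ʷ : ∀ .{{_ : NonZero N}} n → zeros {N} (0ʷ {n = n}) ≡ n
zeros-0ʷ n = begin
  zeros (0ʷ {n = n})  ≡⟨ sum-cong-≗ {n} (λ i → δ₀-0 (lookup-replicate i 0#)) ⟩
  ∑[ i < n ] 1        ≡⟨ ∑-const n 1 ⟩
  n ℕ.* 1             ≡⟨ ℕ.*-identityʳ n ⟩
  n                   ∎
  where open ≡-Reasoning

zeros-positive : .{{_ : NonZero N}} (w : Word N n) → ¬ (∀ i → lookup w i ≢ 0#) → 1 ≤ zeros w
zeros-positive w ¬nowhere-0 with any? (λ i → lookup w i ≟ 0#)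
... | yes (i , wᵢ≡0) = ℕ.≤-<-trans z≤n
  (∑-mono-< (λ _ → z≤n) i (ℕ.≤-reflexive (sym (δ₀-0 wᵢ≡0))))
... | no  ∄0         = contradiction (λ i wᵢ≡0 → ∄0 (i , wᵢ≡0)) ¬nowhere-0

module _ {N : ℕ} .{{_ : NonZero N}} where

  coordinate-equidistributed : (g : Matrix N m n) (i : Fin n) → columnGcd g i ≡ 1 →
                               N ℕ.* ∑ᵥ (δ₀ ∘ coordinate g i) ≡ ∑ᵥ {N} {m} (λ _ → 1)
  coordinate-equidistributed {m = m} g i gcdᵢ≡1 = begin
    N ℕ.* ∑ᵥ (δ₀ ∘ φ)                               ≡⟨ ∑-const N _ ⟨
    ∑[ k < N ] ∑ᵥ (δ₀ ∘ φ)                          ≡⟨ sum-cong-≗ (λ k → ∑ᵥ-translate (δ₀ ∘ φ) (k · c)) ⟩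
    ∑[ k < N ] ∑ᵥ (λ a → δ₀ (φ (a ⊕ (k · c))))      ≡⟨ ∑-∑ᵥ-comm (λ k a → δ₀ (φ (a ⊕ (k · c)))) ⟩
    ∑ᵥ (λ a → ∑[ k < N ] δ₀ (φ (a ⊕ (k · c))))      ≡⟨ ∑ᵥ-cong (λ a → sum-cong-≗ (λ k → cong δ₀ (φ-translate a k))) ⟩
    ∑ᵥ (λ a → ∑[ k < N ] δ₀ (k + φ a))              ≡⟨ ∑ᵥ-cong (λ a → ∑-translate δ₀ (φ a)) ⟨
    ∑ᵥ {N} {m} (λ a → sum δ₀)                       ≡⟨ ∑ᵥ-cong {N} {m} (λ a → ∑-δ₀ N) ⟩
    ∑ᵥ {N} {m} (λ a → 1)                            ∎
    where
    open ≡-Reasoning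
    φ = coordinate g i
    c = proj₁ (columnGcd-attained g i)

    φ-translate : ∀ a k → φ (a ⊕ (k · c)) ≡ k + φ a
    φ-translate a k = begin
      φ (a ⊕ (k · c))                   ≡⟨ coordinate-⊕ g i a (k · c) ⟩
      φ a + φ (k · c)                   ≡⟨ cong (φ a +_) (coordinate-· g i k c) ⟩
      φ a + k * φ c                     ≡⟨ cong (λ x → φ a + k * x) (proj₂ (columnGcd-attained g i)) ⟩
      φ a + k * (columnGcd g i mod N)   ≡⟨ cong (λ x → φ a + k * (x mod N)) gcdᵢ≡1 ⟩
      φ a + k * 1#                      ≡⟨ cong (φ a +_) (ℤ/.*-identityʳ N k) ⟩
      φ a + k                           ≡⟨ +-comm (φ a) k ⟩
      k + φ a                           ∎

  average-zeros : (g : Matrix N m n) → (∀ i → columnGcd g i ≡ 1) →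
                  N ℕ.* ∑ᵥ (λ a → zeros (combination a g)) ≡ n ℕ.* ∑ᵥ {N} {m} (λ _ → 1)
  average-zeros {m = m} {n = n} g gcd≡1 = begin
    N ℕ.* ∑ᵥ (λ a → zeros (combination a g))                  ≡⟨ cong (N ℕ.*_) (∑-∑ᵥ-comm (λ i → δ₀ ∘ coordinate g i)) ⟨
    N ℕ.* (∑[ i < n ] ∑ᵥ (δ₀ ∘ coordinate g i))               ≡⟨ *-distribˡ-sum N (λ i → ∑ᵥ (δ₀ ∘ coordinate g i)) ⟩
    ∑[ i < n ] (N ℕ.* ∑ᵥ (δ₀ ∘ coordinate g i))               ≡⟨ sum-cong-≗ (λ i → coordinate-equidistributed g i (gcd≡1 i)) ⟩
    ∑[ i < n ] ∑ᵥ {N} {m} (λ _ → 1)                           ≡⟨ ∑-const n _ ⟩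
    n ℕ.* ∑ᵥ {N} {m} (λ _ → 1)                                ∎
    where
    open ≡-Reasoning
    open import Algebra.Properties.Semiring.Sum ℕ.+-*-semiring using (*-distribˡ-sum)

  module _ (g : Matrix N m n) (gcd≡1 : ∀ i → columnGcd g i ≡ 1)
           (has-zero : ∀ a → 1 ≤ zeros (combination a g)) where

    private
      T = ∑ᵥ {N} {m} (λ _ → 1)

    modulus≤length : Vec (ℤ/ N) m → N ≤ n
    modulus≤length a = ℕ.*-cancelʳ-≤ N n T {{>-nonZero (ℕ.≤-<-trans z≤n T-positive)}}
      (ℕ.≤-trans (ℕ.*-monoʳ-≤ N (∑ᵥ-mono-≤ has-zero)) (ℕ.≤-reflexive (average-zeros g gcd≡1)))
      where
      T-positive : ∑ᵥ {N} {m} (λ _ → 0) < T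
      T-positive = ∑ᵥ-mono-< (λ _ → z≤n) a (s≤s z≤n)

    modulus<length : ∀ a → 1 < zeros (combination a g) → N < n
    modulus<length a many-zeros = ℕ.*-cancelʳ-< T N n
      (ℕ.<-≤-trans (ℕ.*-monoʳ-< N (∑ᵥ-mono-< has-zero a many-zeros))
        (ℕ.≤-reflexive (average-zeros g gcd≡1)))

columnGcd∣N : (g : Matrix N m n) (i : Fin n) → columnGcd g i ∣ N
columnGcd∣N []      i = ∣-refl
columnGcd∣N (r ∷ g) i = ∣-trans (gcd[m,n]∣n (toℕ (lookup r i)) _) (columnGcd∣N g i)

columnGcd∣entry : (g : Matrix N m n) (j : Fin m) (i : Fin n) → columnGcd g i ∣ toℕ (entry g j i)
columnGcd∣entry (r ∷ g) zero    i = gcd[m,n]∣m (toℕ (lookup r i)) _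
columnGcd∣entry (r ∷ g) (suc j) i =
  ∣-trans (gcd[m,n]∣n (toℕ (lookup r i)) _) (columnGcd∣entry g j i)

prime⇒columnGcd≡1 : .{{_ : NonZero N}} → Prime N → (g : Matrix N m n) (i : Fin n) →
                    (∃ λ j → entry g j i ≢ 0#) → columnGcd g i ≡ 1
prime⇒columnGcd≡1 {N} N-prime g i (j , gⱼᵢ≢0) with prime⇒irreducible N-prime (columnGcd∣N g i)
... | inj₁ gcd≡1 = gcd≡1
... | inj₂ gcd≡N = contradiction gⱼᵢ≡0 gⱼᵢ≢0
  where
  gⱼᵢ%N≡0 : toℕ (entry g j i) % N ≡ 0
  gⱼᵢ%N≡0 = n∣m⇒m%n≡0 _ N (subst (_∣ toℕ (entry g j i)) gcd≡N (columnGcd∣entry g j i))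

  gⱼᵢ≡0 : entry g j i ≡ 0#
  gⱼᵢ≡0 = trans (sym (mod-toℕ (entry g j i))) (mod-cong (trans gⱼᵢ%N≡0 (sym (m*n%n≡0 0 N))))

modulus-bound : ∀ .{{_ : NonZero N}} d (g : Matrix N m (suc d)) →
                (∃ λ a → 0ʷ ≡ combination a g) → (∀ a → 1 ≤ zeros (combination a g)) →
                ¬ (N ≡ 1 × d ≡ 0) → (∀ i → columnGcd g i ≡ 1) → N ≤ d
modulus-bound {N} zero    g (a , _)    has-zero ¬trivial gcd≡1 = contradiction
  (ℕ.≤-antisym (modulus≤length g gcd≡1 has-zero a) (>-nonZero⁻¹ N) , refl) ¬trivial
modulus-bound     (suc d) g (a , 0≡ag) has-zero _        gcd≡1 =
  s≤s⁻¹ (modulus<length g gcd≡1 has-zero a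
    (subst (1 <_) (trans (sym (zeros-0ʷ (suc (suc d)))) (cong zeros 0≡ag)) (s≤s (s≤s z≤n))))

corollary2p13 : ∀ {ℓ} (N : ℕ) .{{_ : NonZero N}} (d m : ℕ)
    (C : Pred (Word N (suc d)) ℓ) (g : Matrix N m (suc d)) →
    IsLinearCode C → IsExtended C → IsGeneratingMatrix g C → IsThin C →
    (¬ (N ≡ 1 × d ≡ 0) → (∀ (i : Fin (suc d)) → columnGcd g i ≡ 1) → N ≤ d)
    × (Prime N → (∀ (i : Fin (suc d)) → ∃ λ (j : Fin m) → entry g j i ≢ 0#) → N ≤ d)
corollary2p13 N d m C g linear _ generates thin =
  modulus-bound d g zero-word has-zero ,
  λ N-prime nonzero-columns →
    modulus-bound d g zero-word has-zero
      (λ (N≡1 , _) → ¬prime[1] (subst Prime N≡1 N-prime))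
      (λ i → prime⇒columnGcd≡1 N-prime g i (nonzero-columns i))
  where
  zero-word : ∃ λ a → 0ʷ ≡ combination a g
  zero-word = Equivalence.to (generates 0ʷ) (IsLinearCode.0-closed linear)

  has-zero : ∀ a → 1 ≤ zeros (combination a g)
  has-zero a = zeros-positive (combination a g)
    (λ nowhere-0 → thin (_ , Equivalence.from (generates _) (a , refl) , nowhere-0))
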